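{- For each $k\in\{5,6,7,8,9,10\}$, the admissible triples $(t,\lambda_1,\lambda_2)$ of valency $k$ are exactly the following. \begin{itemize} \item $k=5$: $(4,5,-1)$, $(0,\sqrt5,-\sqrt5)$, $(-4,1,-5)$. \item $k=6$: $(5,6,-1)$, $(1,3,-2)$, $(0,\sqrt6,-\sqrt6)$, $(-1,2,-3)$, $(-5,1,-6)$. \item $k=7$: $(6,7,-1)$, $(0,\sqrt7,-\sqrt7)$, $(-6,1,-7)$. \item $k=8$: $(7,8,-1)$, $(2,4,-2)$, $(0,\sqrt8,-\sqrt8)$, $(-2,2,-4)$, $(-7,1,-8)$. \item $k=9$: $(8,9,-1)$, $(0,3,-3)$, $(-8,1,-9)$. \item $k=10$: $(9,10,-1)$, $(3,5,-2)$, $(0,\sqrt{10},-\sqrt{10})$, $(-3,2,-5)$, $(-9,1,-10)$. \end{itemize}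
   Context: These triples are the possible parameters of a signed $k$-regular graph with exactly two distinct eigenvalues $\lambda_1>\lambda_2$, whose adjacency matrix $A$ satisfies $A^2-tA-kI=0$. For a positive integer $k$, a triple $(t,\lambda_1,\lambda_2)$ is called admissible of valency $k$ if $t$ is an integer in the interval $[-k+1,k-1]$, $\lambda_1=\frac{t+\sqrt{t^2+4k}}{2}$ and $\lambda_2=\frac{t-\sqrt{t^2+4k}}{2}$ (so $t=\lambda_1+\lambda_2$ and $k=-\lambda_1\lambda_2$), and either $t=0$ or $b=t^2+4k$ is a perfect square. -}

module Defs where

open import Data.Nat.Base as ℕ using (ℕ; zero; suc)
import Data.Nat.Properties as ℕ
open import Data.Nat.Tactic.RingSolver using (solve-∀)
open import Data.Integer.Base as ℤ using (ℤ; +_; +[1+_]; ∣_∣)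
import Data.Integer.Properties as ℤ
open import Data.Rational.Unnormalised.Base as ℚ
  using (ℚᵘ; mkℚᵘ; 0ℚᵘ; 1ℚᵘ; ½; *≡*; *≤*; *<*; ↧ₙ_)
import Data.Rational.Unnormalised.Properties as ℚ
open import Data.Rational.Unnormalised.Solver using (module +-*-Solver)
open import Data.List.Base using (List)
import Data.List.Membership.Setoid as Membership
open import Data.Product.Base using (_×_; _,_; ∃; ∃-syntax)
open import Data.Product.Relation.Binary.Pointwise.NonDependent using (_×ₛ_)
open import Data.Sum.Base using (_⊎_; inj₁; inj₂)
open import Function.Bundles using (_⇔_)
open import Level using (0ℓ)
open import Relation.Binary.Bundles using (Setoid)
open import Relation.Binary.PropositionalEquality as ≡ using (_≡_; refl)
open import Relation.Nullary using (yes; no; contradiction)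

-- The real numbers: Cauchy sequences of rationals, identified when their
-- difference tends to 0.

IsCauchy : (ℕ → ℚᵘ) → Set
IsCauchy x = ∀ ε → 0ℚᵘ ℚ.< ε →
  ∃[ N ] ∀ m n → N ℕ.≤ m → N ℕ.≤ n → ℚ.∣ x m ℚ.- x n ∣ ℚ.< ε

record ℝ : Set where
  constructor mkℝ
  field
    seq      : ℕ → ℚᵘ
    isCauchy : IsCauchy seq

open ℝ public

infix 4 _≈_

record _≈_ (x y : ℝ) : Set where
  constructor mk≈
  field
    close : ∀ ε → 0ℚᵘ ℚ.< ε →
      ∃[ N ] ∀ n → N ℕ.≤ n → ℚ.∣ seq x n ℚ.- seq y n ∣ ℚ.< ε

open _≈_ public

half-pos : ∀ {ε} → 0ℚᵘ ℚ.< ε → 0ℚᵘ ℚ.< ½ ℚ.* ε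
half-pos {ε} 0<ε =
  ℚ.<-respˡ-≃ (ℚ.*-zeroʳ ½) (ℚ.*-monoʳ-<-pos ½ 0<ε)

half+half : ∀ ε → ½ ℚ.* ε ℚ.+ ½ ℚ.* ε ℚ.≃ ε
half+half ε = ℚ.≃-trans (ℚ.≃-sym (ℚ.*-distribʳ-+ ε ½ ½))
  (ℚ.≃-trans (ℚ.*-congʳ {ε} {½ ℚ.+ ½} {1ℚᵘ} (*≡* refl)) (ℚ.*-identityˡ ε))

<-halves : ∀ {p q ε} → p ℚ.< ½ ℚ.* ε → q ℚ.< ½ ℚ.* ε → p ℚ.+ q ℚ.< ε
<-halves {ε = ε} p< q< = ℚ.<-respʳ-≃ (half+half ε) (ℚ.+-mono-< p< q<)

∣x-x∣<ε : ∀ p {ε} → 0ℚᵘ ℚ.< ε → ℚ.∣ p ℚ.- p ∣ ℚ.< ε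
∣x-x∣<ε p = ℚ.<-respˡ-≃ (ℚ.≃-sym (ℚ.∣-∣-cong (ℚ.+-inverseʳ p)))

∣-∣-swap : ∀ p q → ℚ.∣ p ℚ.- q ∣ ℚ.≃ ℚ.∣ q ℚ.- p ∣
∣-∣-swap p q = ℚ.≃-trans
  (ℚ.∣-∣-cong (solve 2 (λ a b → a :- b := :- (b :- a)) ℚ.≃-refl p q))
  (ℚ.∣-p∣≃∣p∣ (q ℚ.- p))
  where open +-*-Solver

∣-∣-triangle : ∀ p q r → ℚ.∣ p ℚ.- r ∣ ℚ.≤ ℚ.∣ p ℚ.- q ∣ ℚ.+ ℚ.∣ q ℚ.- r ∣
∣-∣-triangle p q r = ℚ.≤-trans
  (ℚ.≤-reflexive (ℚ.∣-∣-cong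
    (solve 3 (λ a b c → a :- c := (a :- b) :+ (b :- c)) ℚ.≃-refl p q r)))
  (ℚ.∣p+q∣≤∣p∣+∣q∣ (p ℚ.- q) (q ℚ.- r))
  where open +-*-Solver

∣-∣-bound : ∀ {p q ε} → p ℚ.< q ℚ.+ ε → q ℚ.< p ℚ.+ ε → ℚ.∣ p ℚ.- q ∣ ℚ.< ε
∣-∣-bound {p} {q} {ε} p< q< with ℚ.∣p∣≡p∨∣p∣≡-p (p ℚ.- q)
... | inj₁ eq rewrite eq = ℚ.<-respʳ-≃
  (solve 2 (λ b e → (b :+ e) :- b := e) ℚ.≃-refl q ε)
  (ℚ.+-monoˡ-< (ℚ.- q) p<)
  where open +-*-Solver
... | inj₂ eq rewrite eq = ℚ.<-respˡ-≃
  (solve 2 (λ a b → b :- a := :- (a :- b)) ℚ.≃-refl p q)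
  (ℚ.<-respʳ-≃ (solve 2 (λ a e → (a :+ e) :- a := e) ℚ.≃-refl p ε)
  (ℚ.+-monoˡ-< (ℚ.- p) q<))
  where open +-*-Solver

≈-refl : ∀ {x} → x ≈ x
≈-refl {x} = mk≈ λ ε 0<ε → 0 , λ n _ → ∣x-x∣<ε (seq x n) 0<ε

≈-sym : ∀ {x y} → x ≈ y → y ≈ x
≈-sym {x} {y} x≈y = mk≈ λ ε 0<ε → let N , h = close x≈y ε 0<ε in
  N , λ n N≤n → ℚ.<-respˡ-≃ (∣-∣-swap (seq x n) (seq y n)) (h n N≤n)

≈-trans : ∀ {x y z} → x ≈ y → y ≈ z → x ≈ z
≈-trans {x} {y} {z} x≈y y≈z = mk≈ λ ε 0<ε →
  let M , g = close x≈y _ (half-pos 0<ε)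
      N , h = close y≈z _ (half-pos 0<ε)
  in M ℕ.⊔ N , λ n le → ℚ.≤-<-trans
       (∣-∣-triangle (seq x n) (seq y n) (seq z n))
       (<-halves {ε = ε} (g n (ℕ.m⊔n≤o⇒m≤o M N le)) (h n (ℕ.m⊔n≤o⇒n≤o M N le)))

ℝ-setoid : Setoid 0ℓ 0ℓ
ℝ-setoid = record
  { Carrier       = ℝ
  ; _≈_           = _≈_
  ; isEquivalence = record { refl = ≈-refl ; sym = ≈-sym ; trans = ≈-trans }
  }

opaque
  const-cauchy : ∀ q → IsCauchy (λ _ → q)
  const-cauchy q ε 0<ε = 0 , λ _ _ _ _ → ∣x-x∣<ε q 0<ε

fromℚ : ℚᵘ → ℝ
fromℚ q = mkℝ (λ _ → q) (const-cauchy q)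

fromℤ : ℤ → ℝ
fromℤ i = fromℚ (i ℚ./ 1)

infix  8 -ᴿ_
infixl 7 _*ᴿ_
infixl 6 _+ᴿ_ _-ᴿ_

opaque
  +-cauchy : ∀ x y → IsCauchy (λ n → seq x n ℚ.+ seq y n)
  +-cauchy x y ε 0<ε =
    let M , g = isCauchy x _ (half-pos 0<ε)
        N , h = isCauchy y _ (half-pos 0<ε)
    in M ℕ.⊔ N , λ m n p q → ℚ.≤-<-trans
         (split (seq x m) (seq y m) (seq x n) (seq y n))
         (<-halves {ε = ε}
           (g m n (ℕ.m⊔n≤o⇒m≤o M N p) (ℕ.m⊔n≤o⇒m≤o M N q))
           (h m n (ℕ.m⊔n≤o⇒n≤o M N p) (ℕ.m⊔n≤o⇒n≤o M N q)))
    where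
    open +-*-Solver
    split : ∀ a b c d →
      ℚ.∣ (a ℚ.+ b) ℚ.- (c ℚ.+ d) ∣ ℚ.≤ ℚ.∣ a ℚ.- c ∣ ℚ.+ ℚ.∣ b ℚ.- d ∣
    split a b c d = ℚ.≤-trans
      (ℚ.≤-reflexive (ℚ.∣-∣-cong
        (solve 4 (λ a b c d → (a :+ b) :- (c :+ d) := (a :- c) :+ (b :- d))
          ℚ.≃-refl a b c d)))
      (ℚ.∣p+q∣≤∣p∣+∣q∣ (a ℚ.- c) (b ℚ.- d))

_+ᴿ_ : ℝ → ℝ → ℝ
x +ᴿ y = mkℝ (λ n → seq x n ℚ.+ seq y n) (+-cauchy x y)

opaque
  neg-cauchy : ∀ x → IsCauchy (λ n → ℚ.- seq x n)
  neg-cauchy x ε 0<ε =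
    let N , h = isCauchy x ε 0<ε
    in N , λ m n p q → ℚ.<-respˡ-≃ (flip (seq x m) (seq x n)) (h m n p q)
    where
    open +-*-Solver
    flip : ∀ a b → ℚ.∣ a ℚ.- b ∣ ℚ.≃ ℚ.∣ (ℚ.- a) ℚ.- (ℚ.- b) ∣
    flip a b = ℚ.≃-trans (∣-∣-swap a b)
      (ℚ.∣-∣-cong (solve 2 (λ a b → b :- a := (:- a) :- (:- b)) ℚ.≃-refl a b))

-ᴿ_ : ℝ → ℝ
-ᴿ x = mkℝ (λ n → ℚ.- seq x n) (neg-cauchy x)

_-ᴿ_ : ℝ → ℝ → ℝ
x -ᴿ y = x +ᴿ (-ᴿ y)

bounded : ∀ x → ∃[ B ] 0ℚᵘ ℚ.< B × ∃[ N ] ∀ n → N ℕ.≤ n → ℚ.∣ seq x n ∣ ℚ.< B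
bounded x =
  let 0<1   = *<* (ℤ.+<+ ℕ.z<s)
      N , h = isCauchy x 1ℚᵘ 0<1
      c     = seq x N
  in 1ℚᵘ ℚ.+ ℚ.∣ c ∣
   , ℚ.+-mono-<-≤ 0<1 (ℚ.nonNegative⁻¹ ℚ.∣ c ∣ {{ℚ.∣-∣-nonNeg c}})
   , N , λ n N≤n → ℚ.≤-<-trans
       (ℚ.≤-trans
         (ℚ.≤-reflexive (ℚ.∣-∣-cong
           (solve 2 (λ a b → a := (a :- b) :+ b) ℚ.≃-refl (seq x n) c)))
         (ℚ.∣p+q∣≤∣p∣+∣q∣ (seq x n ℚ.- c) c))
       (ℚ.+-monoˡ-< ℚ.∣ c ∣ (h n N N≤n ℕ.≤-refl))
  where open +-*-Solver

shrink : ∀ {B ε} → 0ℚᵘ ℚ.< B → 0ℚᵘ ℚ.< ε →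
  ∃[ δ ] 0ℚᵘ ℚ.< δ × (∀ u v → ℚ.∣ u ∣ ℚ.< B → ℚ.∣ v ∣ ℚ.< δ → ℚ.∣ u ℚ.* v ∣ ℚ.< ε)
shrink {B} {ε} 0<B 0<ε = δ , 0<δ , bound
  where
  instance
    B⁺ : ℚ.Positive B
    B⁺ = ℚ.positive 0<B
    B≢0 : ℚ.NonZero B
    B≢0 = ℚ.pos⇒nonZero B
    B⁻¹⁺ : ℚ.Positive (ℚ.1/ B)
    B⁻¹⁺ = ℚ.1/pos⇒pos B
  δ : ℚᵘ
  δ = ℚ.1/ B ℚ.* ε
  0<δ : 0ℚᵘ ℚ.< δ
  0<δ = ℚ.<-respˡ-≃ (ℚ.*-zeroʳ (ℚ.1/ B)) (ℚ.*-monoʳ-<-pos (ℚ.1/ B) 0<ε)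
  B*δ : B ℚ.* δ ℚ.≃ ε
  B*δ = ℚ.≃-trans (ℚ.≃-sym (ℚ.*-assoc B (ℚ.1/ B) ε))
    (ℚ.≃-trans (ℚ.*-congʳ (ℚ.*-inverseʳ B)) (ℚ.*-identityˡ ε))
  bound : ∀ u v → ℚ.∣ u ∣ ℚ.< B → ℚ.∣ v ∣ ℚ.< δ → ℚ.∣ u ℚ.* v ∣ ℚ.< ε
  bound u v u< v< = ℚ.≤-<-trans
    (ℚ.≤-trans (ℚ.≤-reflexive (ℚ.∣p*q∣≃∣p∣*∣q∣ u v))
      (ℚ.*-monoˡ-≤-nonNeg ℚ.∣ v ∣ {{ℚ.∣-∣-nonNeg v}} (ℚ.<⇒≤ u<)))
    (ℚ.<-respʳ-≃ B*δ (ℚ.*-monoʳ-<-pos B v<))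

opaque
  *-cauchy : ∀ x y → IsCauchy (λ n → seq x n ℚ.* seq y n)
  *-cauchy x y ε 0<ε =
    let B , 0<B , K , bx = bounded x
        C , 0<C , L , by = bounded y
        δ , 0<δ , sx = shrink 0<B (half-pos 0<ε)
        η , 0<η , sy = shrink 0<C (half-pos 0<ε)
        M , g = isCauchy x η 0<η
        N , h = isCauchy y δ 0<δ
        P = (K ℕ.⊔ L) ℕ.⊔ (M ℕ.⊔ N)
        toK = λ {i} (p : P ℕ.≤ i) → ℕ.m⊔n≤o⇒m≤o K L (ℕ.m⊔n≤o⇒m≤o (K ℕ.⊔ L) (M ℕ.⊔ N) p)
        toL = λ {i} (p : P ℕ.≤ i) → ℕ.m⊔n≤o⇒n≤o K L (ℕ.m⊔n≤o⇒m≤o (K ℕ.⊔ L) (M ℕ.⊔ N) p)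
        toM = λ {i} (p : P ℕ.≤ i) → ℕ.m⊔n≤o⇒m≤o M N (ℕ.m⊔n≤o⇒n≤o (K ℕ.⊔ L) (M ℕ.⊔ N) p)
        toN = λ {i} (p : P ℕ.≤ i) → ℕ.m⊔n≤o⇒n≤o M N (ℕ.m⊔n≤o⇒n≤o (K ℕ.⊔ L) (M ℕ.⊔ N) p)
    in P , λ m n p q → ℚ.≤-<-trans
         (split (seq x m) (seq y m) (seq x n) (seq y n))
         (<-halves {ε = ε}
           (sx (seq x m) (seq y m ℚ.- seq y n) (bx m (toK p)) (h m n (toN p) (toN q)))
           (sy (seq y n) (seq x m ℚ.- seq x n) (by n (toL q)) (g m n (toM p) (toM q))))
    where
    open +-*-Solver
    split : ∀ a b c d →
      ℚ.∣ a ℚ.* b ℚ.- c ℚ.* d ∣ ℚ.≤ ℚ.∣ a ℚ.* (b ℚ.- d) ∣ ℚ.+ ℚ.∣ d ℚ.* (a ℚ.- c) ∣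
    split a b c d = ℚ.≤-trans
      (ℚ.≤-reflexive (ℚ.∣-∣-cong
        (solve 4 (λ a b c d → a :* b :- c :* d := a :* (b :- d) :+ d :* (a :- c))
          ℚ.≃-refl a b c d)))
      (ℚ.∣p+q∣≤∣p∣+∣q∣ (a ℚ.* (b ℚ.- d)) (d ℚ.* (a ℚ.- c)))

_*ᴿ_ : ℝ → ℝ → ℝ
x *ᴿ y = mkℝ (λ n → seq x n ℚ.* seq y n) (*-cauchy x y)

opaque
  isqrt : ℕ → ℕ
  isqrt zero    = 0
  isqrt (suc n) with suc (isqrt n) ℕ.* suc (isqrt n) ℕ.≤? suc n
  ... | yes _ = suc (isqrt n)
  ... | no  _ = isqrt n

  isqrt-lower : ∀ n → isqrt n ℕ.* isqrt n ℕ.≤ n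
  isqrt-lower zero    = ℕ.z≤n
  isqrt-lower (suc n) with suc (isqrt n) ℕ.* suc (isqrt n) ℕ.≤? suc n
  ... | yes le = le
  ... | no  _  = ℕ.m≤n⇒m≤1+n (isqrt-lower n)

  isqrt-upper : ∀ n → n ℕ.< suc (isqrt n) ℕ.* suc (isqrt n)
  isqrt-upper zero    = ℕ.z<s
  isqrt-upper (suc n) with suc (isqrt n) ℕ.* suc (isqrt n) ℕ.≤? suc n
  ... | yes _ = ℕ.≤-<-trans (isqrt-upper n)
                  (ℕ.*-mono-< (ℕ.n<1+n (suc (isqrt n))) (ℕ.n<1+n (suc (isqrt n))))
  ... | no ¬le = ℕ.≰⇒> ¬le

-- The n-th approximant of √ b is ⌊(n+1)√b⌋ / (n+1).

√-scaled : ℕ → ℕ → ℕ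
√-scaled b n = isqrt (b ℕ.* (suc n ℕ.* suc n))

√-approx : ℕ → ℕ → ℚᵘ
√-approx b n = + √-scaled b n ℚ./ suc n

square-cancel-< : ∀ {a b} → a ℕ.* a ℕ.< b ℕ.* b → a ℕ.< b
square-cancel-< {a} {b} lt with a ℕ.<? b
... | yes a<b = a<b
... | no  a≮b = contradiction (ℕ.*-mono-≤ (ℕ.≮⇒≥ a≮b) (ℕ.≮⇒≥ a≮b)) (ℕ.<⇒≱ lt)

scaled-cross : ∀ b m n → √-scaled b m ℕ.* suc n ℕ.< suc (√-scaled b n) ℕ.* suc m
scaled-cross b m n = square-cancel-< (begin-strict
  (r ℕ.* suc n) ℕ.* (r ℕ.* suc n)               ≡⟨ swap r (suc n) ⟩
  (r ℕ.* r) ℕ.* (suc n ℕ.* suc n)               ≤⟨ ℕ.*-monoˡ-≤ (suc n ℕ.* suc n) (isqrt-lower (b ℕ.* (suc m ℕ.* suc m))) ⟩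
  b ℕ.* (suc m ℕ.* suc m) ℕ.* (suc n ℕ.* suc n) ≡⟨ swap′ b (suc m ℕ.* suc m) (suc n ℕ.* suc n) ⟩
  b ℕ.* (suc n ℕ.* suc n) ℕ.* (suc m ℕ.* suc m) <⟨ ℕ.*-monoˡ-< (suc m ℕ.* suc m) (isqrt-upper (b ℕ.* (suc n ℕ.* suc n))) ⟩
  (suc s ℕ.* suc s) ℕ.* (suc m ℕ.* suc m)       ≡⟨ swap (suc s) (suc m) ⟨
  (suc s ℕ.* suc m) ℕ.* (suc s ℕ.* suc m)       ∎)
  where
  open ℕ.≤-Reasoning
  r = √-scaled b m
  s = √-scaled b n
  swap : ∀ x y → (x ℕ.* y) ℕ.* (x ℕ.* y) ≡ (x ℕ.* x) ℕ.* (y ℕ.* y)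
  swap = solve-∀
  swap′ : ∀ x y z → x ℕ.* y ℕ.* z ≡ x ℕ.* z ℕ.* y
  swap′ = solve-∀

mk-< : ∀ {a b c d} → a ℕ.* suc d ℕ.< c ℕ.* suc b → mkℚᵘ (+ a) b ℚ.< mkℚᵘ (+ c) d
mk-< {a} {b} {c} {d} lt = *<*
  (≡.subst₂ ℤ._<_ (ℤ.pos-* a (suc d)) (ℤ.pos-* c (suc b)) (ℤ.+<+ lt))

mk-≤ : ∀ {a b c d} → a ℕ.* suc d ℕ.≤ c ℕ.* suc b → mkℚᵘ (+ a) b ℚ.≤ mkℚᵘ (+ c) d
mk-≤ {a} {b} {c} {d} le = *≤*
  (≡.subst₂ ℤ._≤_ (ℤ.pos-* a (suc d)) (ℤ.pos-* c (suc b)) (ℤ.+≤+ le))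

mk-≃ : ∀ {a b c d} → a ℕ.* suc d ≡ c ℕ.* suc b → mkℚᵘ (+ a) b ℚ.≃ mkℚᵘ (+ c) d
mk-≃ {a} {b} {c} {d} eq = *≡*
  (≡.subst₂ _≡_ (ℤ.pos-* a (suc d)) (ℤ.pos-* c (suc b)) (≡.cong +_ eq))

mk-+ : ∀ a b c d →
  mkℚᵘ (+ a) b ℚ.+ mkℚᵘ (+ c) d ≡
  (+ (a ℕ.* suc d ℕ.+ c ℕ.* suc b)) ℚ./ (suc b ℕ.* suc d)
mk-+ a b c d = ≡.cong (λ z → z ℚ./ (suc b ℕ.* suc d))
  (≡.cong₂ ℤ._+_ (≡.sym (ℤ.pos-* a (suc d))) (≡.sym (ℤ.pos-* c (suc b))))

small : ∀ c {ε} → 0ℚᵘ ℚ.< ε → ∀ n → c ℕ.* ↧ₙ ε ℕ.≤ n → mkℚᵘ (+ c) n ℚ.< ε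
small c {mkℚᵘ +[1+ p ] d} _ n le = mk-< {c} {n} {suc p} {d}
  (ℕ.<-≤-trans (ℕ.s≤s le) (ℕ.m≤n*m (suc n) (suc p)))
small c {mkℚᵘ (+ 0)     d} (*<* (ℤ.+<+ ())) n le
small c {mkℚᵘ ℤ.-[1+ p ] d} (*<* ()) n le

approx-< : ∀ b m n → √-approx b m ℚ.< √-approx b n ℚ.+ mkℚᵘ (+ 1) n
approx-< b m n = ℚ.<-respʳ-≃ (ℚ.≃-trans eq (ℚ.≃-reflexive (≡.sym (mk-+ s n 1 n))))
  (mk-< {√-scaled b m} {m} {suc s} {n} (scaled-cross b m n))
  where
  s = √-scaled b n
  lem : ∀ s n → suc s ℕ.* (n ℕ.* n) ≡ (s ℕ.* n ℕ.+ 1 ℕ.* n) ℕ.* n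
  lem = solve-∀
  eq : mkℚᵘ (+ suc s) n ℚ.≃ (+ (s ℕ.* suc n ℕ.+ 1 ℕ.* suc n)) ℚ./ (suc n ℕ.* suc n)
  eq = mk-≃ {suc s} {n} {s ℕ.* suc n ℕ.+ 1 ℕ.* suc n} (lem s (suc n))

opaque
  √-cauchy : ∀ b → IsCauchy (√-approx b)
  √-cauchy b ε 0<ε =
    1 ℕ.* ↧ₙ ε , λ m n p q → ∣-∣-bound
      (ℚ.<-trans (approx-< b m n) (ℚ.+-monoʳ-< (√-approx b n) (small 1 {ε} 0<ε n q)))
      (ℚ.<-trans (approx-< b n m) (ℚ.+-monoʳ-< (√-approx b m) (small 1 {ε} 0<ε m p)))

√_ : ℕ → ℝ
√ b = mkℝ (√-approx b) (√-cauchy b)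

√-nonNeg : ∀ b n → 0ℚᵘ ℚ.≤ seq (√ b) n
√-nonNeg b n = mk-≤ {0} {0} {√-scaled b n} {n} ℕ.z≤n

square-below : ∀ b r n → r ℕ.* r ℕ.≤ b ℕ.* (suc n ℕ.* suc n) →
  (+ r ℚ./ suc n) ℚ.* (+ r ℚ./ suc n) ℚ.≤ + b ℚ./ 1
square-below b r n le = ℚ.≤-respˡ-≃ (ℚ.≃-reflexive sq)
  (mk-≤ {r ℕ.* r} {n ℕ.+ n ℕ.* suc n} {b} {0}
    (≡.subst (ℕ._≤ b ℕ.* (suc n ℕ.* suc n)) (≡.sym (ℕ.*-identityʳ (r ℕ.* r))) le))
  where
  sq : (+ (r ℕ.* r)) ℚ./ (suc n ℕ.* suc n) ≡ (+ r ℚ./ suc n) ℚ.* (+ r ℚ./ suc n)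
  sq = ≡.cong (λ z → z ℚ./ (suc n ℕ.* suc n)) (ℤ.pos-* r r)

square-above-ℕ : ∀ b r N → 1 ℕ.≤ N → r ℕ.≤ b ℕ.* N →
  b ℕ.* (N ℕ.* N) ℕ.< suc r ℕ.* suc r →
  b ℕ.* (N ℕ.* N) ℕ.< r ℕ.* r ℕ.+ (2 ℕ.* b ℕ.+ 1) ℕ.* N
square-above-ℕ b r N 1≤N r≤bN lt = begin-strict
  b ℕ.* (N ℕ.* N)                        <⟨ lt ⟩
  suc r ℕ.* suc r                        ≡⟨ expand r ⟩
  r ℕ.* r ℕ.+ (2 ℕ.* r ℕ.+ 1)            ≤⟨ ℕ.+-monoʳ-≤ (r ℕ.* r)
                                              (ℕ.+-mono-≤ (ℕ.*-monoʳ-≤ 2 r≤bN) 1≤N) ⟩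
  r ℕ.* r ℕ.+ (2 ℕ.* (b ℕ.* N) ℕ.+ N)    ≡⟨ collect r b N ⟩
  r ℕ.* r ℕ.+ (2 ℕ.* b ℕ.+ 1) ℕ.* N      ∎
  where
  open ℕ.≤-Reasoning
  expand : ∀ r → suc r ℕ.* suc r ≡ r ℕ.* r ℕ.+ (2 ℕ.* r ℕ.+ 1)
  expand = solve-∀
  collect : ∀ r b N → r ℕ.* r ℕ.+ (2 ℕ.* (b ℕ.* N) ℕ.+ N) ≡
                      r ℕ.* r ℕ.+ (2 ℕ.* b ℕ.+ 1) ℕ.* N
  collect = solve-∀

mk-+-same : ∀ a c d → mkℚᵘ (+ (a ℕ.+ c)) d ℚ.≃ mkℚᵘ (+ a) d ℚ.+ mkℚᵘ (+ c) d
mk-+-same a c d = ℚ.≃-trans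
  (mk-≃ {a ℕ.+ c} {d} {a ℕ.* suc d ℕ.+ c ℕ.* suc d} (lem a c (suc d)))
  (ℚ.≃-reflexive (≡.sym (mk-+ a d c d)))
  where
  lem : ∀ a c D → (a ℕ.+ c) ℕ.* (D ℕ.* D) ≡ (a ℕ.* D ℕ.+ c ℕ.* D) ℕ.* D
  lem = solve-∀

square-above : ∀ b r n c →
  b ℕ.* (suc n ℕ.* suc n) ℕ.< r ℕ.* r ℕ.+ c ℕ.* suc n →
  + b ℚ./ 1 ℚ.< (+ r ℚ./ suc n) ℚ.* (+ r ℚ./ suc n) ℚ.+ mkℚᵘ (+ c) n
square-above b r n c lt = ℚ.<-respʳ-≃
  (ℚ.≃-trans (mk-+-same (r ℕ.* r) (c ℕ.* suc n) d)
    (ℚ.+-cong (ℚ.≃-reflexive (≡.cong (λ z → mkℚᵘ z d) (ℤ.pos-* r r)))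
      (mk-≃ {c ℕ.* suc n} {d} {c} {n} (ℕ.*-assoc c (suc n) (suc n)))))
  (mk-< {b} {0} {r ℕ.* r ℕ.+ c ℕ.* suc n} {d}
    (≡.subst (b ℕ.* (suc n ℕ.* suc n) ℕ.<_) (≡.sym (ℕ.*-identityʳ _)) lt))
  where d = n ℕ.+ n ℕ.* suc n

√-scaled-≤ : ∀ b n → √-scaled b n ℕ.≤ b ℕ.* suc n
√-scaled-≤ b n = ℕ.s≤s⁻¹ (square-cancel-< {r} {suc (b ℕ.* suc n)} (begin-strict
  r ℕ.* r                                 ≤⟨ isqrt-lower (b ℕ.* (suc n ℕ.* suc n)) ⟩
  b ℕ.* (suc n ℕ.* suc n)                 ≤⟨ ℕ.*-monoˡ-≤ (suc n ℕ.* suc n) (b≤b*b b) ⟩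
  (b ℕ.* b) ℕ.* (suc n ℕ.* suc n)         ≡⟨ lem b (suc n) ⟩
  (b ℕ.* suc n) ℕ.* (b ℕ.* suc n)         <⟨ ℕ.*-mono-< (ℕ.n<1+n (b ℕ.* suc n)) (ℕ.n<1+n (b ℕ.* suc n)) ⟩
  suc (b ℕ.* suc n) ℕ.* suc (b ℕ.* suc n) ∎))
  where
  open ℕ.≤-Reasoning
  r = √-scaled b n
  b≤b*b : ∀ b → b ℕ.≤ b ℕ.* b
  b≤b*b zero    = ℕ.z≤n
  b≤b*b (suc b) = ℕ.m≤m*n (suc b) (suc b)
  lem : ∀ x y → (x ℕ.* x) ℕ.* (y ℕ.* y) ≡ (x ℕ.* y) ℕ.* (x ℕ.* y)
  lem = solve-∀

√-square : ∀ b → √ b *ᴿ √ b ≈ fromℤ (+ b)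
√-square b = mk≈ λ ε 0<ε → c ℕ.* ↧ₙ ε , λ n le →
  ∣-∣-bound {√-approx b n ℚ.* √-approx b n} {+ b ℚ./ 1}
  (ℚ.≤-<-trans
    (square-below b (√-scaled b n) n (isqrt-lower (b ℕ.* (suc n ℕ.* suc n))))
    (ℚ.<-respˡ-≃ (ℚ.+-identityʳ (+ b ℚ./ 1)) (ℚ.+-monoʳ-< (+ b ℚ./ 1) 0<ε)))
  (ℚ.<-trans
    (square-above b (√-scaled b n) n c
      (square-above-ℕ b (√-scaled b n) (suc n) ℕ.z<s (√-scaled-≤ b n)
        (isqrt-upper (b ℕ.* (suc n ℕ.* suc n)))))
    (ℚ.+-monoʳ-< (√-approx b n ℚ.* √-approx b n) (small c {ε} 0<ε n le)))
  where c = 2 ℕ.* b ℕ.+ 1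

-- t² + 4k, as a natural number.

disc : ℕ → ℤ → ℕ
disc k t = ∣ t ∣ ℕ.^ 2 ℕ.+ 4 ℕ.* k

record Admissible (k : ℕ) .{{_ : ℕ.NonZero k}} (t : ℤ) (λ₁ λ₂ : ℝ) : Set where
  constructor mkAdmissible
  field
    lower  : ℤ.- + k ℤ.+ + 1 ℤ.≤ t
    upper  : t ℤ.≤ + k ℤ.- + 1
    λ₁-def : λ₁ ≈ (fromℤ t +ᴿ √ disc k t) *ᴿ fromℚ ½
    λ₂-def : λ₂ ≈ (fromℤ t -ᴿ √ disc k t) *ᴿ fromℚ ½
    square : t ≡ + 0 ⊎ ∃[ m ] disc k t ≡ m ℕ.^ 2

open Membership (≡.setoid ℤ ×ₛ (ℝ-setoid ×ₛ ℝ-setoid)) public using (_∈_)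

AdmissibleExactly : (k : ℕ) .{{_ : ℕ.NonZero k}} → List (ℤ × ℝ × ℝ) → Set
AdmissibleExactly k τs =
  ∀ t λ₁ λ₂ → Admissible k t λ₁ λ₂ ⇔ (t , λ₁ , λ₂) ∈ τs

{-# OPTIONS --safe #-}

-- If k = p q with p, q ≥ 1, then t = p − q has t² + 4k = (p + q)², which makes
-- (p − q, p, −q) admissible; and t = 0 gives ±√(4k)/2 = ±√k. Since t determines
-- λ₁ and λ₂, completeness of a list concerns only the values of t, of which
-- there are finitely many: ∣t∣ < k, and whether t² + 4k is a square is decidable.

module Submission where

open import Defs
open import Data.Integer.Base as ℤ using (ℤ; +_; -_; -[1+_]; ∣_∣; _⊖_)
import Data.Integer.Properties as ℤ
import Data.Integer.Tactic.RingSolver as ℤ-Solver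
open import Data.List.Base using (List; map; _∷_; [])
open import Data.List.Membership.DecPropositional ℤ._≟_ using (_∈?_) renaming (_∈_ to _∈ℤ_)
open import Data.List.Relation.Unary.All using (All; _∷_; [])
open import Data.List.Relation.Unary.Any using (here; there)
open import Data.Nat.Base as ℕ using (ℕ; zero; suc)
import Data.Nat.Properties as ℕ
import Data.Nat.Tactic.RingSolver as ℕ-Solver
open import Data.Product.Base using (_×_; _,_; proj₁; ∃-syntax)
open import Data.Rational.Unnormalised.Base as ℚ using (½; *≡*)
import Data.Rational.Unnormalised.Properties as ℚ
open import Data.Rational.Unnormalised.Solver using (module +-*-Solver)
open import Data.Sum.Base using (_⊎_; inj₁; inj₂; map₁)
open import Function.Bundles using (mk⇔)
open import Relation.Binary.PropositionalEquality as ≡ using (_≡_; refl)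
open import Relation.Nullary.Decidable
  using (Dec; True; toWitness; map′; _×-dec_; _⊎-dec_; _→-dec_)

-- Equality of reals and exact values of square roots.

≃⇒≈ : ∀ {x y} → (∀ n → seq x n ℚ.≃ seq y n) → x ≈ y
≃⇒≈ {x} {y} x≃y = mk≈ λ ε 0<ε → 0 , λ n _ →
  ℚ.<-respˡ-≃ (ℚ.∣-∣-cong (ℚ.+-congʳ (seq x n) (ℚ.-‿cong (x≃y n)))) (∣x-x∣<ε (seq x n) 0<ε)

-ᴿ-cong : ∀ {x y} → x ≈ y → -ᴿ x ≈ -ᴿ y
-ᴿ-cong {x} {y} x≈y = mk≈ λ ε 0<ε → let N , h = close x≈y ε 0<ε in
  N , λ n N≤n → ℚ.<-respˡ-≃
    (ℚ.≃-trans (∣-∣-swap (seq x n) (seq y n))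
      (ℚ.∣-∣-cong (solve 2 (λ a b → b :- a := (:- a) :- (:- b)) ℚ.≃-refl (seq x n) (seq y n))))
    (h n N≤n)
  where open +-*-Solver

-- `isqrt` is opaque and is used only through its two bounds. With r the root of m², r² ≤ m² < (m +
-- 1)² and m² < (r + 1)² lose their squares to r ≤ m and m ≤ r.
isqrt-square : ∀ m → isqrt (m ℕ.* m) ≡ m
isqrt-square m = ℕ.≤-antisym
  (ℕ.s≤s⁻¹ (square-cancel-<
    (ℕ.≤-<-trans (isqrt-lower (m ℕ.* m)) (ℕ.*-mono-< (ℕ.n<1+n m) (ℕ.n<1+n m)))))
  (ℕ.s≤s⁻¹ (square-cancel-< (isqrt-upper (m ℕ.* m))))

-- The radicand m²(n + 1)² is itself a square, so no rounding occurs and every approximant is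
-- already the limit.
√-approx-square : ∀ m n → √-approx (m ℕ.^ 2) n ℚ.≃ + m ℚ./ 1
√-approx-square m n = mk-≃ {√-scaled (m ℕ.^ 2) n} {n} {m} {0}
  (≡.trans (ℕ.*-identityʳ _)
    (≡.trans (≡.cong isqrt (regroup m (suc n))) (isqrt-square (m ℕ.* suc n))))
  where
  regroup : ∀ m N → m ℕ.* (m ℕ.* 1) ℕ.* (N ℕ.* N) ≡ (m ℕ.* N) ℕ.* (m ℕ.* N)
  regroup = ℕ-Solver.solve-∀

-- Halving the n-th approximant of √ (4 k) gives exactly the (2n+1)-st one of √ k.
√4k/2≈√k : ∀ k → √ (4 ℕ.* k) *ᴿ fromℚ ½ ≈ √ k
√4k/2≈√k k = mk≈ λ ε 0<ε → let N , h = √-cauchy k ε 0<ε in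
  N , λ n N≤n → ℚ.<-respˡ-≃
    (ℚ.∣-∣-cong (ℚ.+-congˡ (ℚ.- √-approx k n) (ℚ.≃-sym (halve n))))
    (h (n ℕ.+ suc n) n (ℕ.≤-trans N≤n (ℕ.m≤m+n n (suc n))) N≤n)
  where
  regroup : ∀ k N → 4 ℕ.* k ℕ.* (N ℕ.* N) ≡ k ℕ.* ((N ℕ.+ N) ℕ.* (N ℕ.+ N))
  regroup = ℕ-Solver.solve-∀
  double : ∀ r N → r ℤ.* + 1 ℤ.* (N ℤ.+ N) ≡ r ℤ.* (N ℤ.* + 2)
  double = ℤ-Solver.solve-∀
  halve : ∀ n → √-approx (4 ℕ.* k) n ℚ.* ½ ℚ.≃ √-approx k (n ℕ.+ suc n)
  halve n rewrite regroup k (suc n) =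
    *≡* (double (+ √-scaled k (n ℕ.+ suc n)) (+ suc n))

-- Two families of admissible triples.

1-k≡-[k-1] : ∀ k → ℤ.- + suc k ℤ.+ + 1 ≡ ℤ.- + k
1-k≡-[k-1] k = ≡.trans (ℤ.[1+m]⊖[1+n]≡m⊖n 0 k) (ℤ.⊖-≤ {0} {k} ℕ.z≤n)

√-admissible : ∀ k .{{_ : ℕ.NonZero k}} → Admissible k (+ 0) (√ k) (-ᴿ √ k)
√-admissible k@(suc k-1) = mkAdmissible
  (≡.subst (ℤ._≤ + 0) (≡.sym (1-k≡-[k-1] k-1)) ℤ.neg-≤-pos)
  (ℤ.+≤+ ℕ.z≤n)
  -- `disc k (+ 0)` computes to `4 ℕ.* k`, so only the summand 0 in the defining formula remains to
  -- be absorbed.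
  (≈-trans (≈-sym (√4k/2≈√k k)) (≃⇒≈ λ n →
    ℚ.*-congʳ (ℚ.≃-sym (ℚ.+-identityˡ (√-approx (4 ℕ.* k) n)))))
  (≈-trans (≈-sym (-ᴿ-cong (√4k/2≈√k k))) (≃⇒≈ λ n →
    ℚ.≃-trans (ℚ.neg-distribˡ-* (√-approx (4 ℕ.* k) n) ½)
      (ℚ.*-congʳ (ℚ.≃-sym (ℚ.+-identityˡ (ℚ.- √-approx (4 ℕ.* k) n))))))
  (inj₁ refl)

disc-⊖ : ∀ p q → disc (p ℕ.* q) (p ⊖ q) ≡ (p ℕ.+ q) ℕ.^ 2
disc-⊖ p q with ℕ.≤-total p q
-- Writing the larger number as the smaller plus `d` turns ∣p - q∣ into `d` and leaves a polynomial
-- identity over ℕ.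
... | inj₁ p≤q with d , refl ← ℕ.m≤n⇒∃[o]m+o≡n p≤q
  rewrite ℤ.∣⊖∣-≤ p≤q | ℕ.m+n∸m≡n p d = expand p d
  where
  expand : ∀ p d → d ℕ.* (d ℕ.* 1) ℕ.+ 4 ℕ.* (p ℕ.* (p ℕ.+ d)) ≡
                   (p ℕ.+ (p ℕ.+ d)) ℕ.* ((p ℕ.+ (p ℕ.+ d)) ℕ.* 1)
  expand = ℕ-Solver.solve-∀
... | inj₂ q≤p with d , refl ← ℕ.m≤n⇒∃[o]m+o≡n q≤p
  rewrite ℤ.⊖-≥ q≤p | ℕ.m+n∸m≡n q d = expand q d
  where
  expand : ∀ q d → d ℕ.* (d ℕ.* 1) ℕ.+ 4 ℕ.* ((q ℕ.+ d) ℕ.* q) ≡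
                   (q ℕ.+ d ℕ.+ q) ℕ.* ((q ℕ.+ d ℕ.+ q) ℕ.* 1)
  expand = ℕ-Solver.solve-∀

half-sum : ∀ p q → ((p ⊖ q) ℚ./ 1 ℚ.+ + (p ℕ.+ q) ℚ./ 1) ℚ.* ½ ℚ.≃ + p ℚ./ 1
-- With `_⊖_` turned into a subtraction, cross-multiplying gives a ring identity; the factors `+ 1`
-- and `+ 2` are denominators.
half-sum p q rewrite ≡.sym (ℤ.m-n≡m⊖n p q) = *≡* (expand (+ p) (+ q))
  where
  expand : ∀ x y → ((x ℤ.- y) ℤ.* + 1 ℤ.+ (x ℤ.+ y) ℤ.* + 1) ℤ.* + 1 ℤ.* + 1 ≡ x ℤ.* + 2
  expand = ℤ-Solver.solve-∀

half-difference : ∀ p q → ((p ⊖ q) ℚ./ 1 ℚ.- + (p ℕ.+ q) ℚ./ 1) ℚ.* ½ ℚ.≃ (- + q) ℚ./ 1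
half-difference p q rewrite ≡.sym (ℤ.m-n≡m⊖n p q) = *≡* (expand (+ p) (+ q))
  where
  expand : ∀ x y → ((x ℤ.- y) ℤ.* + 1 ℤ.+ (ℤ.- (x ℤ.+ y)) ℤ.* + 1) ℤ.* + 1 ℤ.* + 1 ≡ (ℤ.- y) ℤ.* + 2
  expand = ℤ-Solver.solve-∀

integral-admissible : ∀ p q .{{_ : ℕ.NonZero p}} .{{_ : ℕ.NonZero q}} →
  Admissible (p ℕ.* q) {{ℕ.m*n≢0 p q}} (p ⊖ q) (fromℤ (+ p)) (fromℤ (- + q))
integral-admissible p@(suc p-1) q@(suc q-1) = mkAdmissible
  -- Here `p ℕ.* q` computes to `suc pq-1`. Both bounds follow from -(q - 1) ≤ p - q ≤ p - 1, since
  -- p - 1 and q - 1 are at most pq - 1.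
  (≡.subst₂ ℤ._≤_ (≡.sym (1-k≡-[k-1] pq-1)) (≡.sym ⊖-pred)
    (ℤ.≤-trans (ℤ.neg-mono-≤ (ℤ.+≤+ q-1≤pq-1))
      (≡.subst (ℤ._≤ p-1 ⊖ q-1) (ℤ.⊖-≤ {0} {q-1} ℕ.z≤n) (ℤ.⊖-monoˡ-≤ q-1 ℕ.z≤n))))
  (≡.subst (ℤ._≤ + pq-1) (≡.sym ⊖-pred)
    (ℤ.≤-trans (ℤ.m⊖n≤m p-1 q-1) (ℤ.+≤+ p-1≤pq-1)))
  (≃⇒≈ λ n → ℚ.≃-sym (ℚ.≃-trans
    (ℚ.*-congʳ (ℚ.+-congʳ ((p ⊖ q) ℚ./ 1) (√-disc n)))
    (half-sum p q)))
  (≃⇒≈ λ n → ℚ.≃-sym (ℚ.≃-trans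
    (ℚ.*-congʳ (ℚ.+-congʳ ((p ⊖ q) ℚ./ 1) (ℚ.-‿cong (√-disc n))))
    (half-difference p q)))
  (inj₂ (p ℕ.+ q , disc-⊖ p q))
  where
  pq-1 = q-1 ℕ.+ p-1 ℕ.* q
  ⊖-pred : p ⊖ q ≡ p-1 ⊖ q-1
  ⊖-pred = ℤ.[1+m]⊖[1+n]≡m⊖n p-1 q-1
  q-1≤pq-1 : q-1 ℕ.≤ pq-1
  q-1≤pq-1 = ℕ.m≤m+n q-1 (p-1 ℕ.* q)
  p-1≤pq-1 : p-1 ℕ.≤ pq-1
  p-1≤pq-1 = ℕ.≤-trans (ℕ.m≤m*n p-1 q) (ℕ.m≤n+m (p-1 ℕ.* q) q-1)
  √-disc : ∀ n → √-approx (disc (p ℕ.* q) (p ⊖ q)) n ℚ.≃ + (p ℕ.+ q) ℚ./ 1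
  √-disc n rewrite disc-⊖ p q = √-approx-square (p ℕ.+ q) n

-- Completeness of a list by finite search.

square? : ∀ d → Dec (∃[ m ] d ≡ m ℕ.^ 2)
square? d = map′ (λ (m , _ , eq) → m , eq) (λ (m , eq) → m , ℕ.s≤s (root≤ m eq) , eq)
  -- A root satisfies m ≤ m² = d, so searching below `suc d` misses none.
  (ℕ.anyUpTo? (λ m → d ℕ.≟ m ℕ.^ 2) (suc d))
  where
  root≤ : ∀ m → d ≡ m ℕ.^ 2 → m ℕ.≤ d
  root≤ zero    _    = ℕ.z≤n
  root≤ (suc m) refl = ℕ.m≤m*n (suc m) (suc m ℕ.* 1)

-- The discriminant depends on t only through ∣t∣, so natural numbers below k suffice, each one
-- answering for both signs. This bounded form is what makes the condition decidable.
Covers : ℕ → List ℤ → Set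
Covers k ts = ∀ {n} → n ℕ.< k → n ≡ 0 ⊎ ∃[ m ] disc k (+ n) ≡ m ℕ.^ 2 →
  + n ∈ℤ ts × - + n ∈ℤ ts

covers? : ∀ k ts → Dec (Covers k ts)
covers? k ts = ℕ.allUpTo? (λ n →
  (n ℕ.≟ 0 ⊎-dec square? (disc k (+ n))) →-dec (+ n ∈? ts ×-dec - + n ∈? ts)) k

∣t∣<k : ∀ k .{{_ : ℕ.NonZero k}} t → ℤ.- + k ℤ.+ + 1 ℤ.≤ t → t ℤ.≤ + k ℤ.- + 1 → ∣ t ∣ ℕ.< k
∣t∣<k (suc k) (+ n)    _     t≤k-1 = ℕ.s≤s (ℤ.drop‿+≤+ t≤k-1)
∣t∣<k (suc k) -[1+ n ] 1-k≤t _     = ℕ.s≤s (ℤ.drop‿+≤+ (ℤ.neg-cancel-≤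
  (≡.subst (ℤ._≤ -[1+ n ]) (1-k≡-[k-1] k) 1-k≤t)))

covers⇒∈ : ∀ {k} .{{_ : ℕ.NonZero k}} {ts t λ₁ λ₂} → Covers k ts → Admissible k t λ₁ λ₂ → t ∈ℤ ts
covers⇒∈ {k} {t = t} covers (mkAdmissible lower upper _ _ square)
  -- `disc k t` and `disc k (+ ∣ t ∣)` compute to the same number, so `square` also serves for
  -- `∣ t ∣`; the sign of `t` then selects the membership.
  with t | covers (∣t∣<k k t lower upper) (map₁ (≡.cong ∣_∣) square)
... | + _      | +n∈ , _ = +n∈
... | -[1+ _ ] | _ , -n∈ = -n∈

admissible-resp-≈ : ∀ {k} .{{_ : ℕ.NonZero k}} {t λ₁ λ₂ μ₁ μ₂} →
  λ₁ ≈ μ₁ → λ₂ ≈ μ₂ → Admissible k t μ₁ μ₂ → Admissible k t λ₁ λ₂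
admissible-resp-≈ λ₁≈μ₁ λ₂≈μ₂ (mkAdmissible lower upper μ₁-def μ₂-def square) =
  mkAdmissible lower upper (≈-trans λ₁≈μ₁ μ₁-def) (≈-trans λ₂≈μ₂ μ₂-def) square

admissible-unique : ∀ {k} .{{_ : ℕ.NonZero k}} {t λ₁ λ₂ μ₁ μ₂} →
  Admissible k t λ₁ λ₂ → Admissible k t μ₁ μ₂ → λ₁ ≈ μ₁ × λ₂ ≈ μ₂
admissible-unique A B =
  ≈-trans (A .Admissible.λ₁-def) (≈-sym (B .Admissible.λ₁-def)) ,
  ≈-trans (A .Admissible.λ₂-def) (≈-sym (B .Admissible.λ₂-def))

-- For a concrete list the `True` argument is settled by evaluation, so completeness is computed and
-- only the admissibility of each listed triple is supplied.
admissibleExactly : ∀ {k} .{{_ : ℕ.NonZero k}} {τs} {_ : True (covers? k (map proj₁ τs))} →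
  All (λ (t , λ₁ , λ₂) → Admissible k t λ₁ λ₂) τs → AdmissibleExactly k τs
admissibleExactly {k} {τs} {covers} all t λ₁ λ₂ =
  mk⇔ (λ A → complete all A (covers⇒∈ (toWitness covers) A)) (sound all)
  where
  sound : ∀ {σs} → All (λ (t , λ₁ , λ₂) → Admissible k t λ₁ λ₂) σs →
    (t , λ₁ , λ₂) ∈ σs → Admissible k t λ₁ λ₂
  sound (B ∷ _)  (here (refl , λ₁≈ , λ₂≈)) = admissible-resp-≈ λ₁≈ λ₂≈ B
  sound (_ ∷ Bs) (there τ∈)                = sound Bs τ∈
  complete : ∀ {σs} → All (λ (t , λ₁ , λ₂) → Admissible k t λ₁ λ₂) σs →
    Admissible k t λ₁ λ₂ → t ∈ℤ map proj₁ σs → (t , λ₁ , λ₂) ∈ σs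
  complete (B ∷ _)  A (here refl) = here (refl , admissible-unique A B)
  complete (_ ∷ Bs) A (there t∈)  = there (complete Bs A t∈)

theorem2p2 : AdmissibleExactly 5
    ( (+ 4 , fromℤ (+ 5) , fromℤ (- + 1))
    ∷ (+ 0 , √ 5 , -ᴿ √ 5)
    ∷ (- + 4 , fromℤ (+ 1) , fromℤ (- + 5))
    ∷ [] )
    × AdmissibleExactly 6
    ( (+ 5 , fromℤ (+ 6) , fromℤ (- + 1))
    ∷ (+ 1 , fromℤ (+ 3) , fromℤ (- + 2))
    ∷ (+ 0 , √ 6 , -ᴿ √ 6)
    ∷ (- + 1 , fromℤ (+ 2) , fromℤ (- + 3))
    ∷ (- + 5 , fromℤ (+ 1) , fromℤ (- + 6))
    ∷ [] )
    × AdmissibleExactly 7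
    ( (+ 6 , fromℤ (+ 7) , fromℤ (- + 1))
    ∷ (+ 0 , √ 7 , -ᴿ √ 7)
    ∷ (- + 6 , fromℤ (+ 1) , fromℤ (- + 7))
    ∷ [] )
    × AdmissibleExactly 8
    ( (+ 7 , fromℤ (+ 8) , fromℤ (- + 1))
    ∷ (+ 2 , fromℤ (+ 4) , fromℤ (- + 2))
    ∷ (+ 0 , √ 8 , -ᴿ √ 8)
    ∷ (- + 2 , fromℤ (+ 2) , fromℤ (- + 4))
    ∷ (- + 7 , fromℤ (+ 1) , fromℤ (- + 8))
    ∷ [] )
    × AdmissibleExactly 9
    ( (+ 8 , fromℤ (+ 9) , fromℤ (- + 1))
    ∷ (+ 0 , fromℤ (+ 3) , fromℤ (- + 3))
    ∷ (- + 8 , fromℤ (+ 1) , fromℤ (- + 9))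
    ∷ [] )
    × AdmissibleExactly 10
    ( (+ 9 , fromℤ (+ 10) , fromℤ (- + 1))
    ∷ (+ 3 , fromℤ (+ 5) , fromℤ (- + 2))
    ∷ (+ 0 , √ 10 , -ᴿ √ 10)
    ∷ (- + 3 , fromℤ (+ 2) , fromℤ (- + 5))
    ∷ (- + 9 , fromℤ (+ 1) , fromℤ (- + 10))
    ∷ [] )
theorem2p2 =
    admissibleExactly
      ( integral-admissible 5 1
      ∷ √-admissible 5
      ∷ integral-admissible 1 5
      ∷ [])
  , admissibleExactly
      ( integral-admissible 6 1
      ∷ integral-admissible 3 2
      ∷ √-admissible 6
      ∷ integral-admissible 2 3
      ∷ integral-admissible 1 6
      ∷ [])
  , admissibleExactly
      ( integral-admissible 7 1
      ∷ √-admissible 7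
      ∷ integral-admissible 1 7
      ∷ [])
  , admissibleExactly
      ( integral-admissible 8 1
      ∷ integral-admissible 4 2
      ∷ √-admissible 8
      ∷ integral-admissible 2 4
      ∷ integral-admissible 1 8
      ∷ [])
  , admissibleExactly
      ( integral-admissible 9 1
      -- As 9 is a square, the triple with t = 0 comes from the factorisation 3 · 3.
      ∷ integral-admissible 3 3
      ∷ integral-admissible 1 9
      ∷ [])
  , admissibleExactly
      ( integral-admissible 10 1
      ∷ integral-admissible 5 2
      ∷ √-admissible 10
      ∷ integral-admissible 2 5
      ∷ integral-admissible 1 10
      ∷ [])
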